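{- Let $P$ and $Q$ be finite posets and let $f:P\to Q$ be a surjective order-preserving map such that for every $q\in Q$ and every $p\in f^{ -1}(q)$ the image of $P_{<p}$ under $f$ equals $Q_{<q}$, i.e. $f(P_{<p})=Q_{<q}$. Then $$\mu(Q)=\mu(P)+\sum_{q\in Q}\mu(Q_{<q})\,\mu\big(f^{ -1}(Q_{\ge q})\big).$$
   Context: For a poset $P$ and $p\in P$, $P_{<p}=\{x\in P: x<p\}$ and $P_{\ge p}=\{x\in P:x\ge p\}$. For a finite poset $P$ (possibly empty), $\mu(P)$ denotes the Möbius function value $\mu_{\hat P}(\hat 0,\hat 1)$, where $\hat P$ is $P$ with a new bottom element $\hat 0$ and a new top element $\hat 1$ adjoined; in particular $\mu(\emptyset)=-1$. (Equivalently $\mu(P)$ is the reduced Euler characteristic of the order complex of $P$.) Subsets such as $Q_{<q}$ and $f^{ -1}(Q_{\ge q})$ carry the induced order. The Möbius function is given by $\mu(a,a)=1$ and $\mu(a,b)=-\sum_{a\le z<b}\mu(a,z)$ for $a<b$. -}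

module Defs where

open import Data.Bool.Base using (if_then_else_)
open import Data.Fin.Base using (Fin)
open import Data.Fin.Induction using (spo-wellFounded)
open import Data.Integer.Base using (ℤ; 0ℤ; 1ℤ; _+_; -_)
open import Data.List.Base using (List; []; _∷_; foldr; length; lookup; map)
open import Data.List.Membership.Setoid.Properties using (∈-map⁺)
open import Data.List.Relation.Unary.All as All using (All; []; _∷_)
import Data.List.Relation.Unary.All.Properties as All
open import Data.List.Relation.Unary.AllPairs using (AllPairs; []; _∷_)
open import Data.List.Relation.Unary.Any using (Any; here; there)
open import Data.List.Relation.Unary.Any.Properties using (lookup-index)
open import Data.List.Relation.Unary.Enumerates.Setoid using (IsEnumeration)
open import Data.List.Relation.Unary.Unique.Setoid using (Unique)
open import Data.List.Relation.Unary.Unique.Setoid.Properties using (map⁺)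
open import Data.Product.Base using (Σ; ∃; _×_; _,_; proj₁)
open import Function.Base using (_∘_)
open import Induction.WellFounded using (Acc; acc; WellFounded)
open import Level using (Level; _⊔_) renaming (suc to lsuc)
open import Relation.Binary.Bundles using (DecPoset)
open import Relation.Binary.Core using (Rel)
import Relation.Binary.Construct.Add.Extrema.Equality as AddEquality
import Relation.Binary.Construct.Add.Extrema.NonStrict as AddOrder
import Relation.Binary.Construct.Add.Supremum.Equality as AddSupremum
import Relation.Binary.Construct.NonStrictToStrict as ToStrict
import Relation.Binary.Construct.On as On
open import Relation.Binary.Definitions as Binary using (_Respects_)
open import Relation.Binary.Morphism.Bundles using (PosetHomomorphism)
import Relation.Binary.Properties.Poset as PosetProperties
open import Relation.Nullary.Construct.Add.Extrema using (⊥±; ⊤±; [_])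
open import Relation.Nullary.Decidable using (does; yes; no; _×-dec_)
open import Relation.Nullary.Negation using (contradiction)
open import Relation.Unary using (Pred; Decidable)

private
  variable
    a b ℓ ℓ₁ ℓ₂ ℓ₃ ℓ₄ : Level

∑ : {A : Set a} → List A → (A → ℤ) → ℤ
∑ xs g = foldr _+_ 0ℤ (map g xs)

-- A variant of filter that keeps the evidence for the predicate.
select : {A : Set a} {S : Pred A ℓ} → Decidable S → List A → List (Σ A S)
select S? []       = []
select S? (x ∷ xs) with S? x
... | yes Sx = (x , Sx) ∷ select S? xs
... | no  _  = select S? xs

module _ {A : Set a} {S : Pred A ℓ} (S? : Decidable S) where

  select-All : {R : Pred A ℓ₁} {xs : List A} →
               All R xs → All (R ∘ proj₁) (select S? xs)
  select-All []                    = []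
  select-All {xs = x ∷ _} (r ∷ rs) with S? x
  ... | yes _ = r ∷ select-All rs
  ... | no  _ = select-All rs

  select-AllPairs : {R : Rel A ℓ₁} {xs : List A} → AllPairs R xs →
                    AllPairs (λ u v → R (proj₁ u) (proj₁ v)) (select S? xs)
  select-AllPairs []                    = []
  select-AllPairs {xs = x ∷ _} (r ∷ rs) with S? x
  ... | yes _ = select-All r ∷ select-AllPairs rs
  ... | no  _ = select-AllPairs rs

  select-Any : {R : Pred A ℓ₁} {xs : List A} → (∀ {x} → R x → S x) →
               Any R xs → Any (R ∘ proj₁) (select S? xs)
  select-Any {xs = x ∷ _} R⇒S (here r) with S? x
  ... | yes _  = here r
  ... | no ¬Sx = contradiction (R⇒S r) ¬Sx
  select-Any {xs = x ∷ _} R⇒S (there rs) with S? x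
  ... | yes _ = there (select-Any R⇒S rs)
  ... | no  _ = select-Any R⇒S rs

-- Equality is a setoid equality so that subposets can be Σ-types whose elements
-- are compared by their first components only.
record FinitePoset a ℓ₁ ℓ₂ : Set (lsuc (a ⊔ ℓ₁ ⊔ ℓ₂)) where
  field
    decPoset : DecPoset a ℓ₁ ℓ₂

  open DecPoset decPoset public
  open PosetProperties poset public
    using (_<_; <-isStrictPartialOrder; <-respˡ-≈; <-respʳ-≈)

  field
    elements : List Carrier
    unique   : Unique Eq.setoid elements
    complete : IsEnumeration Eq.setoid elements

  _<?_ : Binary.Decidable _<_
  _<?_ = ToStrict.<-decidable _≈_ _≤_ _≟_ _≤?_

  <-wellFounded : WellFounded _<_
  <-wellFounded x = go (⊏-wellFounded _) (lookup-index (complete x))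
    where
    _⊏_ : Rel (Fin (length elements)) _
    i ⊏ j = lookup elements i < lookup elements j

    ⊏-wellFounded : WellFounded _⊏_
    ⊏-wellFounded = spo-wellFounded
      (On.isStrictPartialOrder (lookup elements) <-isStrictPartialOrder)

    go : ∀ {i} → Acc _⊏_ i → ∀ {y} → y ≈ lookup elements i → Acc _<_ y
    go (acc rs) y≈ = acc λ {z} z<y →
      let z≈ = lookup-index (complete z) in
      go (rs (<-respˡ-≈ z≈ (<-respʳ-≈ y≈ z<y))) z≈

open FinitePoset using (Carrier; poset)

module _ (R : FinitePoset a ℓ₁ ℓ₂) where
  open FinitePoset R hiding (Carrier)

  möbius-acc : (x y : Carrier R) → Acc _<_ y → ℤ
  möbius-acc x y (acc rs) =
    if does (x ≟ y) then 1ℤ else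
    - ∑ (select (λ z → (x ≤? z) ×-dec (z <? y)) elements)
        λ (z , _ , z<y) → möbius-acc x z (rs z<y)

  -- When x ≰ y there is no z with x ≤ z < y, so this yields 0.
  möbius : Carrier R → Carrier R → ℤ
  möbius x y = möbius-acc x y (<-wellFounded y)

module _ (P : FinitePoset a ℓ₁ ℓ₂) where
  open FinitePoset P hiding (Carrier; poset)

  subposet : {S : Pred (Carrier P) ℓ} → Decidable S → S Respects _≈_ →
             FinitePoset (a ⊔ ℓ) ℓ₁ ℓ₂
  subposet {S = S} S? resp = record
    { decPoset = On.decPoset decPoset (proj₁ {B = S})
    ; elements = select S? elements
    ; unique   = select-AllPairs S? unique
    ; complete = λ (x , Sx) →
        select-Any S? (λ x≈y → resp x≈y Sx) (complete x)
    }

infix 8 _↓<_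

_↓<_ : (P : FinitePoset a ℓ₁ ℓ₂) → Carrier P → FinitePoset (a ⊔ ℓ₁ ⊔ ℓ₂) ℓ₁ ℓ₂
P ↓< p = subposet P (_<? p) <-respˡ-≈
  where open FinitePoset P using (_<?_; <-respˡ-≈)

module _ (P : FinitePoset a ℓ₁ ℓ₂) (Q : FinitePoset b ℓ₃ ℓ₄)
         (f : PosetHomomorphism (poset P) (poset Q)) where
  private
    module Q = FinitePoset Q
    module f = PosetHomomorphism f

  preimage≥ : Carrier Q → FinitePoset (a ⊔ ℓ₄) ℓ₁ ℓ₂
  preimage≥ q = subposet P (λ p → q Q.≤? f.⟦ p ⟧) (λ x≈y → Q.≤-respʳ-≈ (f.cong x≈y))

  image : Pred (Carrier P) ℓ → Pred (Carrier Q) (a ⊔ ℓ₃ ⊔ ℓ)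
  image S y = ∃ λ x → S x × f.⟦ x ⟧ Q.≈ y

module _ (P : FinitePoset a ℓ₁ ℓ₂) where
  private module P = FinitePoset P
  open AddEquality P._≈_ using ([≈]-injective)
  open AddOrder P._≤_ using (≤±-isDecPartialOrder)

  hat-decPoset : DecPoset a (a ⊔ ℓ₁) (a ⊔ ℓ₂)
  hat-decPoset = record
    { isDecPartialOrder = ≤±-isDecPartialOrder P.isDecPartialOrder }

  private module P̂ = DecPoset hat-decPoset

  hat : FinitePoset a (a ⊔ ℓ₁) (a ⊔ ℓ₂)
  hat = record
    { decPoset = hat-decPoset
    ; elements = ⊥± ∷ ⊤± ∷ map [_] P.elements
    ; unique   = ((λ ()) ∷ All.map⁺ (All.universal (λ { _ AddSupremum.[ () ] }) P.elements))
               ∷ All.map⁺ (All.universal (λ _ ()) P.elements)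
               ∷ map⁺ P.Eq.setoid P̂.Eq.setoid [≈]-injective P.unique
    ; complete = λ where
        ⊥±    → here P̂.Eq.refl
        ⊤±    → there (here P̂.Eq.refl)
        [ x ] → there (there
          (∈-map⁺ P.Eq.setoid P̂.Eq.setoid AddEquality.[_] (P.complete x)))
    }

  μ : ℤ
  μ = möbius hat ⊥± ⊤±

{-# OPTIONS --safe #-}

-- For q in Q put h q = μ (Q ↓< q); then the h x with x ≤ q sum to -1.  Let k be
-- the same function on the dual of P.  Exchanging a double sum gives
-- μ U = -1 - ∑ₚ k p over any up-set U of P, and in particular for every
-- f⁻¹(Q≥q) with one and the same k.  Therefore
--   ∑_q h q * μ (f⁻¹ Q≥q) = - ∑_q h q - ∑ₚ k p * ∑_{q ≤ f p} h q
--                         = - ∑_q h q + ∑ₚ k p = μ Q - μ P.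
module Submission where

open import Defs
open import Algebra.Bundles using (CommutativeMonoid)
import Algebra.Properties.CommutativeSemigroup as CommutativeSemigroupProperties
open import Data.Bool.Base using (if_then_else_)
open import Data.Bool.Properties using (if-cong-else)
open import Data.Integer.Base using (ℤ; 0ℤ; 1ℤ; -1ℤ; _+_; _-_; _*_; -_)
open import Data.Integer.Properties using
  (+-0-commutativeMonoid; +-identityˡ; +-identityʳ; *-cancelˡ-≡; *-comm;
   *-distribˡ-+; *-zeroʳ)
open import Data.Integer.Tactic.RingSolver using (solve-∀)
open import Data.List.Base using (List; []; _∷_; map)
open import Data.List.Relation.Unary.All using (All; []; _∷_)
open import Data.List.Relation.Unary.AllPairs using ([]; _∷_)
open import Data.List.Relation.Unary.Any using (Any; here; there)
open import Data.List.Relation.Unary.Unique.Setoid using (Unique)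
open import Data.Product.Base using (Σ; _×_; _,_; proj₁)
open import Function.Base using (_∘_; flip; id)
open import Function.Definitions using (Surjective)
open import Induction.WellFounded using (Acc; acc)
open import Level using (Level)
open import Relation.Binary.Definitions using (_Respects_)
open import Relation.Binary.Morphism.Bundles using (PosetHomomorphism)
open import Relation.Binary.Construct.NonStrictToStrict using (≤-<-trans)
import Relation.Binary.Properties.Poset as PosetProperties
open import Relation.Binary.PropositionalEquality.Core
  using (_≡_; refl; sym; trans; cong; cong₂)
open import Relation.Binary.PropositionalEquality.Properties using (module ≡-Reasoning)
open import Relation.Nullary.Construct.Add.Extrema using (⊥±; ⊤±; [_])
open import Relation.Nullary.Decidable using (Dec; does; yes; no; _×-dec_; ¬?)
open import Relation.Nullary.Negation using (¬_; contradiction)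
open import Relation.Unary using (Pred; Decidable; _≐_)
open FinitePoset using (Carrier; poset; elements; _≈_; _<_)
open PosetHomomorphism using (⟦_⟧)

private
  variable
    a b ℓ ℓ₁ ℓ₂ : Level
    A B : Set a

-- Terms guarded by a decidable condition

infixl 5 _when_

-- Guards let all sums run over one full enumeration, so a change of range is a change of condition.
_when_ : ℤ → Dec A → ℤ
n when a? = if does a? then n else 0ℤ

when-yes : ∀ {n} {a? : Dec A} → A → n when a? ≡ n
when-yes {a? = yes _} _ = refl
when-yes {a? = no ¬a} a = contradiction a ¬a

when-no : ∀ {n} {a? : Dec A} → ¬ A → n when a? ≡ 0ℤ
when-no {a? = yes a} ¬a = contradiction a ¬a
when-no {a? = no _}  _  = refl

-- The values are compared only under `A`, which lets an induction hypothesis that needs the guard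
-- be applied.
when-cong : ∀ {m n} {a? : Dec A} {b? : Dec B} →
            (A → B) → (B → A) → (A → m ≡ n) → m when a? ≡ n when b?
when-cong {a? = yes a} {b?} A→B B→A eq = trans (eq a) (sym (when-yes {a? = b?} (A→B a)))
when-cong {a? = no ¬a} {b?} A→B B→A eq = sym (when-no {a? = b?} (¬a ∘ B→A))

when-when : ∀ {n} {a? : Dec A} {b? : Dec B} →
            (B → A) → (n when b?) when a? ≡ n when b?
when-when {a? = yes _}            _   = refl
when-when {a? = no ¬a} {b?} B→A = sym (when-no {a? = b?} (¬a ∘ B→A))

-- With `a?` for `x ≤ p` and `b?` for `x ≈ p`, the first guard on the right is by definition the
-- decision of `x < p`.
when-split : ∀ {n} (a? : Dec A) (b? : Dec B) → (B → A) →
             n when a? ≡ (n when (a? ×-dec ¬? b?)) + (n when b?)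
when-split (yes _) (yes _) _   = sym (+-identityˡ _)
when-split (yes _) (no _)  _   = sym (+-identityʳ _)
when-split (no ¬a) (yes b) B→A = contradiction (B→A b) ¬a
when-split (no _)  (no _)  _   = refl

-- Finite sums

∑-cong : (xs : List A) {g h : A → ℤ} → (∀ x → g x ≡ h x) → ∑ xs g ≡ ∑ xs h
∑-cong []       eq = refl
∑-cong (x ∷ xs) eq = cong₂ _+_ (eq x) (∑-cong xs eq)

∑-zero : (xs : List A) → ∑ xs (λ _ → 0ℤ) ≡ 0ℤ
∑-zero []       = refl
∑-zero (_ ∷ xs) = trans (+-identityˡ _) (∑-zero xs)

∑-distrib-+ : (xs : List A) (g h : A → ℤ) →
              ∑ xs (λ x → g x + h x) ≡ ∑ xs g + ∑ xs h
∑-distrib-+ []       g h = refl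
∑-distrib-+ (x ∷ xs) g h = trans (cong (g x + h x +_) (∑-distrib-+ xs g h))
                                 (interchange (g x) (h x) (∑ xs g) (∑ xs h))
  where open CommutativeSemigroupProperties
          (CommutativeMonoid.commutativeSemigroup +-0-commutativeMonoid)

*-distribˡ-∑ : (c : ℤ) (xs : List A) (g : A → ℤ) →
               c * ∑ xs g ≡ ∑ xs (λ x → c * g x)
*-distribˡ-∑ c []       g = *-zeroʳ c
*-distribˡ-∑ c (x ∷ xs) g = trans (*-distribˡ-+ c (g x) (∑ xs g))
                                  (cong (c * g x +_) (*-distribˡ-∑ c xs g))

∑-comm : (xs : List A) (ys : List B) (g : A → B → ℤ) →
         ∑ xs (λ x → ∑ ys (g x)) ≡ ∑ ys (λ y → ∑ xs (λ x → g x y))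
∑-comm []       ys g = sym (∑-zero ys)
∑-comm (x ∷ xs) ys g = trans (cong (∑ ys (g x) +_) (∑-comm xs ys g))
                             (sym (∑-distrib-+ ys (g x) _))

∑-map : (k : A → B) (xs : List A) (g : B → ℤ) → ∑ (map k xs) g ≡ ∑ xs (g ∘ k)
∑-map k []       g = refl
∑-map k (x ∷ xs) g = cong (g (k x) +_) (∑-map k xs g)

∑-select : {S : Pred A ℓ} (S? : Decidable S) (xs : List A) (g : A → ℤ) →
           ∑ (select S? xs) (g ∘ proj₁) ≡ ∑ xs (λ x → g x when S? x)
∑-select S? []       g = refl
∑-select S? (x ∷ xs) g with S? x
... | yes _ = cong (g x +_) (∑-select S? xs g)
... | no  _ = trans (∑-select S? xs g) (sym (+-identityˡ _))

-- Both sides add `g x * h y` over the related pairs.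
∑-exchange : {R : A → B → Set ℓ} (R? : ∀ x y → Dec (R x y))
             (xs : List A) (ys : List B) (g : A → ℤ) (h : B → ℤ) →
             ∑ xs (λ x → g x * ∑ ys (λ y → h y when R? x y)) ≡
             ∑ ys (λ y → h y * ∑ xs (λ x → g x when R? x y))
∑-exchange R? xs ys g h = begin
  ∑ xs (λ x → g x * ∑ ys (λ y → h y when R? x y))
    ≡⟨ ∑-cong xs (λ x → *-distribˡ-∑ (g x) ys _) ⟩
  ∑ xs (λ x → ∑ ys (λ y → g x * (h y when R? x y)))
    ≡⟨ ∑-comm xs ys _ ⟩
  ∑ ys (λ y → ∑ xs (λ x → g x * (h y when R? x y)))
    ≡⟨ ∑-cong ys (λ y → ∑-cong xs (λ x → transfer (g x) (h y) (R? x y))) ⟩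
  ∑ ys (λ y → ∑ xs (λ x → h y * (g x when R? x y)))
    ≡⟨ ∑-cong ys (λ y → *-distribˡ-∑ (h y) xs _) ⟨
  ∑ ys (λ y → h y * ∑ xs (λ x → g x when R? x y)) ∎
  where
  open ≡-Reasoning
  transfer : ∀ m n (a? : Dec A) → m * (n when a?) ≡ n * (m when a?)
  transfer m n (yes _) = *-comm m n
  transfer m n (no _)  = trans (*-zeroʳ m) (sym (*-zeroʳ n))

-- The Möbius recursion, and sums over one equivalence class

module _ (R : FinitePoset a ℓ₁ ℓ₂) where
  open FinitePoset R using (_≟_; _≤?_; _<?_; <-wellFounded; module Eq)
  private module R = FinitePoset R

  private
    between : ∀ x y → List (Σ R.Carrier λ z → x R.≤ z × z R.< y)
    between x y = select (λ z → (x ≤? z) ×-dec (z <? y)) R.elements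

  -- Recursive calls carry the proof `rs z<y`; this allows replacing it by the canonical
  -- `<-wellFounded z`.
  möbius-acc-irrelevant : ∀ x y (p q : Acc R._<_ y) →
                          möbius-acc R x y p ≡ möbius-acc R x y q
  möbius-acc-irrelevant x y (acc rs) (acc ss) =
    if-cong-else (does (x ≟ y)) (cong -_ (∑-cong (between x y) λ (z , _ , z<y) →
      möbius-acc-irrelevant x z (rs z<y) (ss z<y)))

  möbius-unfold : ∀ x y → möbius R x y ≡
    (if does (x ≟ y) then 1ℤ else
     - ∑ R.elements (λ z → möbius R x z when ((x ≤? z) ×-dec (z <? y))))
  -- `möbius-acc` reduces only on `acc`, so the accessibility proof is generalised to a variable
  -- that can be matched.
  möbius-unfold x y = unfold (<-wellFounded y)
    where
    unfold : (p : Acc R._<_ y) → möbius-acc R x y p ≡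
      (if does (x ≟ y) then 1ℤ else
       - ∑ R.elements (λ z → möbius R x z when ((x ≤? z) ×-dec (z <? y))))
    unfold (acc rs) = if-cong-else (does (x ≟ y)) (cong -_ (trans
      (∑-cong (between x y) λ (z , _ , z<y) →
        möbius-acc-irrelevant x z (rs z<y) (<-wellFounded z))
      (∑-select (λ z → (x ≤? z) ×-dec (z <? y)) R.elements (möbius R x))))

  -- Uniqueness leaves exactly one entry equivalent to `p`. It may differ from `p` itself, hence the
  -- congruence of `g`.
  ∑-single : ∀ {p} {g : R.Carrier → ℤ} → (∀ {x y} → x R.≈ y → g x ≡ g y) →
             ∀ {xs} → Unique Eq.setoid xs → Any (p R.≈_) xs →
             ∑ xs (λ x → g x when (x ≟ p)) ≡ g p
  ∑-single {p} {g} g-cong = single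
    where
    open ≡-Reasoning
    none : ∀ {x xs} → p R.≈ x → All (λ y → ¬ (x R.≈ y)) xs →
           ∑ xs (λ y → g y when (y ≟ p)) ≡ 0ℤ
    none p≈x []                    = refl
    none {xs = y ∷ _} p≈x (x≉y ∷ x≉) = cong₂ _+_
      (when-no {a? = y ≟ p} λ y≈p → x≉y (Eq.sym (Eq.trans y≈p p≈x)))
      (none p≈x x≉)

    single : ∀ {xs} → Unique Eq.setoid xs → Any (p R.≈_) xs →
             ∑ xs (λ x → g x when (x ≟ p)) ≡ g p
    single {x ∷ _} (x≉ ∷ _) (here p≈x) = begin
      _           ≡⟨ cong₂ _+_ (when-yes {a? = x ≟ p} (Eq.sym p≈x)) (none p≈x x≉) ⟩
      g x + 0ℤ    ≡⟨ +-identityʳ (g x) ⟩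
      g x         ≡⟨ g-cong (Eq.sym p≈x) ⟩
      g p         ∎
    single {x ∷ xs} (x≉ ∷ uniq) (there p∈xs) = begin
      _           ≡⟨ cong₂ _+_ (when-no {a? = x ≟ p} (apart x≉ p∈xs)) (single uniq p∈xs) ⟩
      0ℤ + g p    ≡⟨ +-identityˡ (g p) ⟩
      g p         ∎
      where
      apart : ∀ {ys} → All (λ y → ¬ (x R.≈ y)) ys → Any (p R.≈_) ys → ¬ (x R.≈ p)
      apart (x≉y ∷ _) (here p≈y) x≈p = x≉y (Eq.trans x≈p p≈y)
      apart (_ ∷ x≉)  (there p∈) x≈p = apart x≉ p∈ x≈p

-- Möbius values from the added bottom

module _ (P : FinitePoset a ℓ₁ ℓ₂) where
  private module P = FinitePoset P
  open ≡-Reasoning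

  -- This is `μ (P ↓< p)`, as `μ-↓<` shows, but read off inside the single poset `hat P`.
  lower : P.Carrier → ℤ
  lower p = möbius (hat P) ⊥± [ p ]

  private
    -- The `1ℤ` is the summand at `⊥±`; the `0ℤ` is the one at `⊤±`, whose guard fails.
    negate-total : ∀ s → - (1ℤ + (0ℤ + s)) ≡ -1ℤ - s
    negate-total = solve-∀

  lower-unfold : ∀ p →
    lower p ≡ -1ℤ - ∑ P.elements (λ x → lower x when (x P.<? p))
  lower-unfold p = begin
    lower p ≡⟨ möbius-unfold (hat P) ⊥± [ p ] ⟩
    _       ≡⟨ cong (λ s → - (1ℤ + (0ℤ + s))) (∑-map [_] P.elements _) ⟩
    _       ≡⟨ negate-total (∑ P.elements (λ x → lower x when (x P.<? p))) ⟩
    -1ℤ - ∑ P.elements (λ x → lower x when (x P.<? p)) ∎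

  μ-unfold : μ P ≡ -1ℤ - ∑ P.elements lower
  μ-unfold = begin
    μ P ≡⟨ möbius-unfold (hat P) ⊥± ⊤± ⟩
    _   ≡⟨ cong (λ s → - (1ℤ + (0ℤ + s))) (∑-map [_] P.elements _) ⟩
    _   ≡⟨ negate-total (∑ P.elements lower) ⟩
    -1ℤ - ∑ P.elements lower ∎

  -- In `lower-unfold` the point enters only through the guard, and the strict order respects `≈`.
  lower-cong : ∀ {x y} → x P.≈ y → lower x ≡ lower y
  lower-cong {x} {y} x≈y = begin
    lower x ≡⟨ lower-unfold x ⟩
    _       ≡⟨ cong (_-_ -1ℤ) (∑-cong P.elements λ z →
                 when-cong {a? = z P.<? x} {b? = z P.<? y}
                   (P.<-respʳ-≈ x≈y) (P.<-respʳ-≈ (P.Eq.sym x≈y)) (λ _ → refl)) ⟩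
    _       ≡⟨ lower-unfold y ⟨
    lower y ∎

  -- The recursion makes the summand at `p` cancel all the strictly smaller ones up to `-1ℤ`.
  ∑-lower : ∀ p → ∑ P.elements (λ x → lower x when (x P.≤? p)) ≡ -1ℤ
  ∑-lower p = begin
    ∑ P.elements (λ x → lower x when (x P.≤? p))
      ≡⟨ ∑-cong P.elements (λ x → when-split (x P.≤? p) (x P.≟ p) P.reflexive) ⟩
    ∑ P.elements (λ x → (lower x when (x P.<? p)) + (lower x when (x P.≟ p)))
      ≡⟨ ∑-distrib-+ P.elements _ _ ⟩
    s + ∑ P.elements (λ x → lower x when (x P.≟ p))
      ≡⟨ cong (s +_) (∑-single P lower-cong P.unique (P.complete p)) ⟩
    s + lower p
      ≡⟨ cong (s +_) (lower-unfold p) ⟩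
    s + (-1ℤ - s)
      ≡⟨ cancel s ⟩
    -1ℤ ∎
    where
    s = ∑ P.elements (λ x → lower x when (x P.<? p))

    cancel : ∀ n → n + (-1ℤ - n) ≡ -1ℤ
    cancel = solve-∀

-- Down-sets

module _ (P : FinitePoset a ℓ₁ ℓ₂) {S : Pred (Carrier P) ℓ}
         (S? : Decidable S) (resp : S Respects (_≈_ P))
         (down-closed : ∀ {x y} → FinitePoset._≤_ P x y → S y → S x) where
  private
    module P = FinitePoset P
    U = subposet P S? resp
    module U = FinitePoset U
  open ≡-Reasoning

  -- A down-set contains everything below each of its points, so both values obey the same
  -- recursion.
  lower-subposet : ∀ u → lower U u ≡ lower P (proj₁ u)
  lower-subposet u = go u (P.<-wellFounded (proj₁ u))
    where
    go : ∀ u → Acc P._<_ (proj₁ u) → lower U u ≡ lower P (proj₁ u)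
    go u@(x , Sx) (acc rs) = begin
      lower U u
        ≡⟨ lower-unfold U u ⟩
      -1ℤ - ∑ U.elements (λ v → lower U v when (v U.<? u))
        ≡⟨ cong (_-_ -1ℤ) (∑-cong U.elements λ v →
             when-cong {a? = v U.<? u} {b? = proj₁ v P.<? x} id id
               (λ v<u → go v (rs v<u))) ⟩
      -1ℤ - ∑ U.elements (λ v → lower P (proj₁ v) when (proj₁ v P.<? x))
        ≡⟨ cong (_-_ -1ℤ) (∑-select S? P.elements _) ⟩
      -1ℤ - ∑ P.elements (λ y → (lower P y when (y P.<? x)) when S? y)
        -- The outer guard is redundant: `y < x` and `S x` already give `S y`.
        ≡⟨ cong (_-_ -1ℤ) (∑-cong P.elements λ y →
             when-when {a? = S? y} {b? = y P.<? x}
               (λ y<x → down-closed (proj₁ y<x) Sx)) ⟩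
      -1ℤ - ∑ P.elements (λ y → lower P y when (y P.<? x))
        ≡⟨ lower-unfold P x ⟨
      lower P x ∎

  μ-down-set : μ U ≡ -1ℤ - ∑ P.elements (λ x → lower P x when S? x)
  μ-down-set = begin
    μ U
      ≡⟨ μ-unfold U ⟩
    -1ℤ - ∑ U.elements (lower U)
      ≡⟨ cong (_-_ -1ℤ) (∑-cong U.elements lower-subposet) ⟩
    -1ℤ - ∑ U.elements (lower P ∘ proj₁)
      ≡⟨ cong (_-_ -1ℤ) (∑-select S? P.elements (lower P)) ⟩
    -1ℤ - ∑ P.elements (λ x → lower P x when S? x) ∎

-- Principal down-sets and duality

module _ (P : FinitePoset a ℓ₁ ℓ₂) where
  private module P = FinitePoset P
  open ≡-Reasoning

  μ-↓< : ∀ p → μ (P ↓< p) ≡ lower P p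
  μ-↓< p = begin
    μ (P ↓< p)
      ≡⟨ μ-down-set P (P._<? p) P.<-respˡ-≈
           (λ {x} {y} x≤y y<p → ≤-<-trans P._≈_ P._≤_ P.trans P.antisym P.≤-respˡ-≈ x≤y y<p) ⟩
    -1ℤ - ∑ P.elements (λ x → lower P x when (x P.<? p))
      ≡⟨ lower-unfold P p ⟨
    lower P p ∎

  -- The enumeration is kept, so sums over `P` and over its dual share one list.
  dual : FinitePoset a ℓ₁ ℓ₂
  dual = record
    { decPoset = record
      { isDecPartialOrder = record
        { isPartialOrder = PosetProperties.≥-isPartialOrder P.poset
        ; _≟_            = P._≟_
        ; _≤?_           = flip P._≤?_
        }
      }
    ; elements = P.elements
    ; unique   = P.unique
    ; complete = P.complete
    }

module _ (P : FinitePoset a ℓ₁ ℓ₂) where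
  private module P = FinitePoset P
  open ≡-Reasoning

  -- The Möbius number of the elements strictly above a point; the `k` of the overview.
  upper : P.Carrier → ℤ
  upper = lower (dual P)

  -- Count `lower P y * upper x` over pairs `y ≤ x` in two ways: by `∑-lower` for `P` and for its
  -- dual, each inner sum is `-1ℤ`.
  ∑-lower≡∑-upper : ∑ P.elements (lower P) ≡ ∑ P.elements upper
  ∑-lower≡∑-upper = *-cancelˡ-≡ -1ℤ _ _ (begin
    -1ℤ * ∑ P.elements (lower P)
      ≡⟨ against (lower P) (λ y → ∑ P.elements (λ x → upper x when (y P.≤? x)))
           (∑-lower (dual P)) ⟩
    ∑ P.elements (λ y → lower P y * ∑ P.elements (λ x → upper x when (y P.≤? x)))
      ≡⟨ ∑-exchange P._≤?_ P.elements P.elements (lower P) upper ⟩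
    ∑ P.elements (λ x → upper x * ∑ P.elements (λ y → lower P y when (y P.≤? x)))
      ≡⟨ against upper _ (∑-lower P) ⟨
    -1ℤ * ∑ P.elements upper ∎)
    where
    against : (g h : P.Carrier → ℤ) → (∀ x → h x ≡ -1ℤ) →
              -1ℤ * ∑ P.elements g ≡ ∑ P.elements (λ x → g x * h x)
    against g h h≡-1 = trans (*-distribˡ-∑ -1ℤ P.elements g)
      (∑-cong P.elements λ x → trans (*-comm -1ℤ (g x)) (cong (g x *_) (sym (h≡-1 x))))

  μ-dual : μ P ≡ μ (dual P)
  μ-dual = begin
    μ P                              ≡⟨ μ-unfold P ⟩
    -1ℤ - ∑ P.elements (lower P)     ≡⟨ cong (_-_ -1ℤ) ∑-lower≡∑-upper ⟩
    -1ℤ - ∑ P.elements upper         ≡⟨ μ-unfold (dual P) ⟨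
    μ (dual P)                       ∎

-- Up-sets

module _ (P : FinitePoset a ℓ₁ ℓ₂) {S : Pred (Carrier P) ℓ}
         (S? : Decidable S) (resp : S Respects (_≈_ P))
         (up-closed : ∀ {x y} → FinitePoset._≤_ P x y → S x → S y) where

  -- dual (subposet P S? resp) and subposet (dual P) S? resp are definitionally equal.
  μ-up-set : μ (subposet P S? resp) ≡
             -1ℤ - ∑ (elements P) (λ x → upper P x when S? x)
  μ-up-set = trans (μ-dual (subposet P S? resp))
                   (μ-down-set (dual P) S? resp up-closed)

-- Double counting along an order-preserving map

proposition22 : ∀ {a ℓ₁ ℓ₂ b ℓ₃ ℓ₄}
    (P : FinitePoset a ℓ₁ ℓ₂) (Q : FinitePoset b ℓ₃ ℓ₄)
    (f : PosetHomomorphism (poset P) (poset Q)) →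
    Surjective (_≈_ P) (_≈_ Q) ⟦ f ⟧ →
    (∀ (q : Carrier Q) (p : Carrier P) → _≈_ Q (⟦ f ⟧ p) q →
    image P Q f (λ x → _<_ P x p) ≐ (λ y → _<_ Q y q)) →
    μ Q ≡ μ P + ∑ (elements Q) (λ q → μ (Q ↓< q) * μ (preimage≥ P Q f q))
proposition22 P Q f _ _ = begin
  μ Q
    ≡⟨ μ-unfold Q ⟩
  -1ℤ - H
    -- `K` is subtracted to form `μ P` and added back as `-1ℤ * (-1ℤ * K)`, the shape that
    -- `exchanged` supplies.
    ≡⟨ rearrange H K ⟩
  (-1ℤ - K) + (-1ℤ * H + -1ℤ * (-1ℤ * K))
    ≡⟨ cong₂ (λ m s → m + (-1ℤ * H + -1ℤ * s))
         (trans (μ-dual P) (μ-unfold (dual P))) exchanged ⟨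
  μ P + (-1ℤ * H + -1ℤ * ∑ Q.elements (λ q → lower Q q * T q))
    ≡⟨ cong (μ P +_) (cong₂ _+_ (*-distribˡ-∑ -1ℤ Q.elements _)
                                (*-distribˡ-∑ -1ℤ Q.elements _)) ⟩
  μ P + (∑ Q.elements (λ q → -1ℤ * lower Q q) +
         ∑ Q.elements (λ q → -1ℤ * (lower Q q * T q)))
    ≡⟨ cong (μ P +_) (∑-distrib-+ Q.elements _ _) ⟨
  μ P + ∑ Q.elements (λ q → -1ℤ * lower Q q + -1ℤ * (lower Q q * T q))
    ≡⟨ cong (μ P +_) (∑-cong Q.elements term) ⟨
  μ P + ∑ Q.elements (λ q → μ (Q ↓< q) * μ (preimage≥ P Q f q)) ∎
  where
  open ≡-Reasoning
  module P = FinitePoset P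
  module Q = FinitePoset Q
  module f = PosetHomomorphism f
  H = ∑ Q.elements (lower Q)
  K = ∑ P.elements (upper P)

  -- Chosen so that the preimage of the elements above `q` has Möbius number `-1ℤ - T q`.
  T : Q.Carrier → ℤ
  T q = ∑ P.elements (λ p → upper P p when (q Q.≤? f.⟦ p ⟧))

  rearrange : ∀ h k → -1ℤ - h ≡ (-1ℤ - k) + (-1ℤ * h + -1ℤ * (-1ℤ * k))
  rearrange = solve-∀

  -- Summing over `q` first, the range `q ≤ f p` is a principal down-set of `Q`, so `∑-lower` gives
  -- `-1ℤ` for every `p`.
  exchanged : ∑ Q.elements (λ q → lower Q q * T q) ≡ -1ℤ * K
  exchanged = begin
    ∑ Q.elements (λ q → lower Q q * T q)
      ≡⟨ ∑-exchange (λ q p → q Q.≤? f.⟦ p ⟧) Q.elements P.elements (lower Q) (upper P) ⟩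
    ∑ P.elements (λ p →
      upper P p * ∑ Q.elements (λ q → lower Q q when (q Q.≤? f.⟦ p ⟧)))
      ≡⟨ ∑-cong P.elements (λ p → trans
           (cong (upper P p *_) (∑-lower Q f.⟦ p ⟧)) (*-comm (upper P p) -1ℤ)) ⟩
    ∑ P.elements (λ p → -1ℤ * upper P p)
      ≡⟨ *-distribˡ-∑ -1ℤ P.elements (upper P) ⟨
    -1ℤ * K ∎

  expand : ∀ m n → m * (-1ℤ - n) ≡ -1ℤ * m + -1ℤ * (m * n)
  expand = solve-∀

  term : ∀ q → μ (Q ↓< q) * μ (preimage≥ P Q f q) ≡
               -1ℤ * lower Q q + -1ℤ * (lower Q q * T q)
  term q = trans
    (cong₂ _*_ (μ-↓< Q q)
      (μ-up-set P (λ p → q Q.≤? f.⟦ p ⟧) (λ x≈y → Q.≤-respʳ-≈ (f.cong x≈y))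
        -- Monotonicity of `f` makes the preimage an up-set.
        (λ x≤y q≤fx → Q.trans q≤fx (f.mono x≤y))))
    (expand (lower Q q) (T q))
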